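{- Let $s$ be an aperiodic standard episturmian word over a finite alphabet $A$, and let $s=U_1U_2\cdots U_n\cdots$ be a factorization of $s$ where each $U_i$ ($i\ge1$) is a non-empty prefix of $s$. Then there exist indices $i\neq j$ such that $U_i$ and $U_j$ end in different letters.
   Context: An infinite word $s$ over a finite alphabet $A$ is standard episturmian if its set of factors is closed under reversal (if $u$ is a factor so is its reversal) and every left special factor of $s$ is a prefix of $s$; here a factor $u$ is left special if there are distinct letters $x,y\in A$ with $xu$ and $yu$ both factors of $s$. Aperiodic means not ultimately periodic. -}

module Defs where

open import Data.Fin.Base using (Fin)
open import Data.List.Base using (List; _∷_; applyUpTo; concat; reverse)
open import Data.List.NonEmpty.Base using (List⁺; toList)
open import Data.Nat.Base using (ℕ; _+_; _≤_; _<_)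
open import Data.Product.Base using (_×_; ∃-syntax)
open import Function.Bundles using (_↔_)
open import Relation.Binary.PropositionalEquality using (_≡_; _≢_)
open import Relation.Nullary using (¬_)

-- Positions in infinite words, and the blocks of a factorization, are
-- numbered from 0.

Finite : Set → Set
Finite A = ∃[ k ] (A ↔ Fin k)

InfiniteWord : Set → Set
InfiniteWord A = ℕ → A

module _ {A : Set} where

  IsPrefix : List A → InfiniteWord A → Set
  IsPrefix u s = ∃[ n ] u ≡ applyUpTo s n

  IsFactor : List A → InfiniteWord A → Set
  IsFactor u s = ∃[ i ] ∃[ n ] u ≡ applyUpTo (λ j → s (i + j)) n

  ClosedUnderReversal : InfiniteWord A → Set
  ClosedUnderReversal s = ∀ u → IsFactor u s → IsFactor (reverse u) s

  -- That u is itself a factor follows, since factors of factors are factors.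
  IsLeftSpecial : List A → InfiniteWord A → Set
  IsLeftSpecial u s =
    ∃[ x ] ∃[ y ] (x ≢ y × IsFactor (x ∷ u) s × IsFactor (y ∷ u) s)

  IsStandardEpisturmian : InfiniteWord A → Set
  IsStandardEpisturmian s =
    ClosedUnderReversal s × (∀ u → IsLeftSpecial u s → IsPrefix u s)

  IsUltimatelyPeriodic : InfiniteWord A → Set
  IsUltimatelyPeriodic s =
    ∃[ q ] ∃[ p ] (0 < p × (∀ n → q ≤ n → s (n + p) ≡ s n))

  IsAperiodic : InfiniteWord A → Set
  IsAperiodic s = ¬ IsUltimatelyPeriodic s

  -- s = U₀U₁U₂⋯.  The blocks are non-empty, so the finite products U₀⋯Uₙ₋₁
  -- grow without bound and their being prefixes of s determines s.
  IsFactorization : InfiniteWord A → (ℕ → List⁺ A) → Set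
  IsFactorization s U =
    ∀ n → IsPrefix (concat (applyUpTo (λ i → toList (U i)) n)) s

{-# OPTIONS --safe #-}

-- Suppose every block ends in the letter a, and let block j start at
-- position T j.  By aperiodicity there is a least n such that s and its
-- shift by some T j differ at n; let p be the prefix of s of length n.  It is
-- a right special prefix, so reversal makes it a palindrome.  As U j is no
-- longer than p and is followed by p, the palindrome property forces the
-- letter after the occurrence of p at T j to be a, whereas p is followed by a
-- different letter at the beginning of s.  So p a is not a prefix of s, hence
-- neither is any word starting with p a left special, and it follows that
-- all occurrences of p a in s are preceded by the same letters as the first
-- one, as far back as the beginning of s.  Let i be the first occurrence.  If
-- i ≤ n, overlapping palindromes make a the letter after the prefix p.  If
-- i > n, the two occurrences of p a at T j and T (j + 1) are at distance at
-- most n, which yields an occurrence before i.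

module Submission where

open import Axiom.ExcludedMiddle using (ExcludedMiddle)
open import Data.Empty using (⊥)
open import Data.List.Base
  using (List; []; _∷_; _++_; [_]; applyUpTo; applyDownFrom; concat; length; reverse)
open import Data.List.NonEmpty.Base as List⁺
  using (List⁺; toList; last; snocView; _∷ʳ′_)
open import Data.List.Properties
  using (∷-injectiveˡ; ∷-injectiveʳ; applyUpTo-∷ʳ; concat-++; concat-[_];
         length-++; length-applyUpTo; reverse-applyUpTo)
open import Data.Nat.Base
  using (ℕ; zero; suc; _+_; _∸_; _≤_; _<_; s≤s; z<s; s<s)
open import Data.Nat.Properties
open import Data.Product.Base using (_×_; _,_; proj₁; proj₂; ∃-syntax)
open import Data.Sum.Base using (inj₁; inj₂)
open import Function.Base using (_∘_)
open import Level using (0ℓ)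
open import Relation.Binary.PropositionalEquality
  using (_≡_; _≢_; refl; sym; trans; cong; cong₂; subst; module ≡-Reasoning)
open import Relation.Nullary using (¬_; yes; no)
open import Relation.Nullary.Decidable.Core using (decidable-stable)
open import Defs

-- Least witnesses, and words cut from sequences.

least : ExcludedMiddle 0ℓ → (P : ℕ → Set) → ∀ n → P n →
        ∃[ m ] (P m × (∀ {k} → k < m → ¬ P k))
least em P zero    p = zero , p , λ ()
least em P (suc n) p with em {P zero}
... | yes p₀ = zero , p₀ , λ ()
... | no ¬p₀ with m , pₘ , min ← least em (P ∘ suc) n p =
  suc m , pₘ , λ { {zero} _ → ¬p₀ ; {suc k} (s<s k<m) → min k<m }

module _ {A : Set} where

  applyUpTo-cong : ∀ {f g : ℕ → A} n → (∀ {t} → t < n → f t ≡ g t) →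
                   applyUpTo f n ≡ applyUpTo g n
  applyUpTo-cong zero    f≗g = refl
  applyUpTo-cong (suc n) f≗g = cong₂ _∷_ (f≗g z<s) (applyUpTo-cong n (f≗g ∘ s<s))

  applyUpTo-injective : ∀ (f g : ℕ → A) m n → applyUpTo f m ≡ applyUpTo g n →
                        m ≡ n × (∀ {t} → t < m → f t ≡ g t)
  applyUpTo-injective f g zero    zero    eq = refl , λ ()
  applyUpTo-injective f g (suc m) (suc n) eq
    with m≡n , f≗g ← applyUpTo-injective (f ∘ suc) (g ∘ suc) m n (∷-injectiveʳ eq) =
    cong suc m≡n ,
    λ { {zero} _ → ∷-injectiveˡ eq ; {suc t} (s<s t<m) → f≗g t<m }

  applyDownFrom≡applyUpTo : ∀ (f : ℕ → A) n →
    applyDownFrom f n ≡ applyUpTo (λ t → f (n ∸ suc t)) n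
  applyDownFrom≡applyUpTo f zero    = refl
  applyDownFrom≡applyUpTo f (suc n) = cong (f n ∷_) (applyDownFrom≡applyUpTo f n)

  ++≡applyUpTo⇒suffix : ∀ xs {ys : List A} {f} n → xs ++ ys ≡ applyUpTo f n →
    ∃[ m ] ys ≡ applyUpTo (f ∘ (length xs +_)) m
  ++≡applyUpTo⇒suffix []       n       eq = n , eq
  ++≡applyUpTo⇒suffix (x ∷ xs) (suc n) eq = ++≡applyUpTo⇒suffix xs n (∷-injectiveʳ eq)

  last-applyUpTo : ∀ (xs : List⁺ A) f n → toList xs ≡ applyUpTo f (suc n) → last xs ≡ f n
  last-applyUpTo xs f n eq with snocView xs
  ... | ys ∷ʳ′ y = snoc ys f n eq
    where
    snoc : ∀ ys f n → toList (ys List⁺.∷ʳ y) ≡ applyUpTo f (suc n) → y ≡ f n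
    snoc []           f zero    eq = ∷-injectiveˡ eq
    snoc (_ ∷ [])     f (suc n) eq = snoc [] (f ∘ suc) n (∷-injectiveʳ eq)
    snoc (_ ∷ y ∷ ys) f (suc n) eq = snoc (y ∷ ys) (f ∘ suc) n (∷-injectiveʳ eq)
    snoc (_ ∷ [])     f zero    ()
    snoc (_ ∷ _ ∷ _)  f zero    ()

-- Special factors and palindromes.

-- Factors are handled through their positions: Agree i k ℓ says that the
-- factors of length ℓ at i and k are equal, and Agree i 0 ℓ that the one at i
-- is a prefix.
module Episturmian {A : Set} (s : InfiniteWord A) (epi : IsStandardEpisturmian s) where

  Agree : ℕ → ℕ → ℕ → Set
  Agree i k ℓ = ∀ {t} → t < ℓ → s (i + t) ≡ s (k + t)

  window : ℕ → ℕ → List A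
  window i = applyUpTo (λ t → s (i + t))

  Agree-∷ : ∀ {i k ℓ} → s i ≡ s k → Agree (suc i) (suc k) ℓ → Agree i k (suc ℓ)
  Agree-∷ {i} {k} head tail {zero}  _ =
    trans (cong s (+-identityʳ i)) (trans head (cong s (sym (+-identityʳ k))))
  Agree-∷ {i} {k} head tail {suc t} (s<s t<ℓ) =
    trans (cong s (+-suc i t)) (trans (tail t<ℓ) (cong s (sym (+-suc k t))))

  Agree-∷ʳ : ∀ {i k ℓ} → Agree i k ℓ → s (i + ℓ) ≡ s (k + ℓ) → Agree i k (suc ℓ)
  Agree-∷ʳ init last t<1+ℓ with m<1+n⇒m<n∨m≡n t<1+ℓ
  ... | inj₁ t<ℓ  = init t<ℓ
  ... | inj₂ refl = last

  ∷-window : ∀ i ℓ → s i ∷ window (suc i) ℓ ≡ window i (suc ℓ)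
  ∷-window i ℓ = cong₂ _∷_ (cong s (sym (+-identityʳ i)))
                           (applyUpTo-cong ℓ λ {t} _ → cong s (sym (+-suc i t)))

  leftSpecial⇒prefix : ∀ {i k ℓ} → s i ≢ s k → Agree (suc i) (suc k) ℓ →
                       Agree (suc i) 0 ℓ
  leftSpecial⇒prefix {i} {k} {ℓ} si≢sk agree
    with n , eq ← proj₂ epi (window (suc i) ℓ)
           ( s i , s k , si≢sk
           , (i , suc ℓ , ∷-window i ℓ)
           , (k , suc ℓ , trans (cong (s k ∷_) (applyUpTo-cong ℓ agree)) (∷-window k ℓ)))
    = proj₂ (applyUpTo-injective _ s ℓ n eq)

  -- Mirror positions are pairs with `suc (t + u) ≡ ℓ`, which keeps truncated subtraction out of the
  -- later arguments.
  reversal : ∀ i ℓ → ∃[ k ] (∀ {t u} → suc (t + u) ≡ ℓ → s (k + t) ≡ s (i + u))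
  reversal i ℓ with proj₁ epi (window i ℓ) (i , ℓ , refl)
  ... | k , n , eq = k , λ {t} {u} → λ { refl → trans
      (sym (proj₂ (applyUpTo-injective (λ v → s (i + (suc (t + u) ∸ suc v))) _ (suc (t + u)) n (trans (sym reversed) eq)) (s≤s (m≤m+n t u))))
      (cong (λ v → s (i + v)) (m+n∸m≡n t u)) }
    where
    reversed : reverse (window i ℓ) ≡ applyUpTo (λ t → s (i + (ℓ ∸ suc t))) ℓ
    reversed = trans (reverse-applyUpTo _ ℓ) (applyDownFrom≡applyUpTo _ ℓ)

  -- Reversing the factors of length `suc n` at 0 and at `i` gives two occurrences of the reversed
  -- prefix, preceded by the different letters `s n` and `s (i + n)`. So the reversed prefix is left
  -- special, hence equal to the prefix of length `n`.
  rightSpecialPrefix-palindrome : ∀ {i n} → Agree i 0 n → s (i + n) ≢ s n →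
    ∀ {t u} → suc (t + u) ≡ n → s t ≡ s u
  rightSpecialPrefix-palindrome {i} {n} agree differ {t} {u} refl
    with k₀ , rev₀ ← reversal 0 (suc n) | k₁ , rev₁ ← reversal i (suc n) =
    trans (sym (prefix (s≤s (m≤m+n t u))))
          (trans (cong s (sym (+-suc k₀ t))) (rev₀ refl))
    where
    last₀ : s k₀ ≡ s n
    last₀ = trans (cong s (sym (+-identityʳ k₀))) (rev₀ refl)
    last₁ : s k₁ ≡ s (i + n)
    last₁ = trans (cong s (sym (+-identityʳ k₁))) (rev₁ refl)
    tails : Agree (suc k₀) (suc k₁) n
    tails {v} v<n with w , v+w≡n ← m≤n⇒∃[o]m+o≡n v<n = begin
      s (suc k₀ + v)  ≡⟨ cong s (sym (+-suc k₀ v)) ⟩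
      s (k₀ + suc v)  ≡⟨ rev₀ (cong suc v+w≡n) ⟩
      s w             ≡⟨ sym (agree (subst (w <_) v+w≡n (s≤s (m≤n+m w v)))) ⟩
      s (i + w)       ≡⟨ sym (rev₁ (cong suc v+w≡n)) ⟩
      s (k₁ + suc v)  ≡⟨ cong s (+-suc k₁ v) ⟩
      s (suc k₁ + v)  ∎
      where open ≡-Reasoning
    prefix : Agree (suc k₀) 0 n
    prefix = leftSpecial⇒prefix (λ e → differ (trans (sym last₁) (trans (sym e) last₀))) tails

  -- The contradiction around a single block.

  -- The block at suc b has length suc l, and the letters at b and b + suc l
  -- are the last ones of that block's predecessor and of the block itself.
  noMonochromaticBlock : ExcludedMiddle 0ℓ → ∀ {n a} b l →
    Agree (suc b) 0 n → s (suc b + n) ≢ s n →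
    suc l ≤ n → s l ≡ a → s b ≡ a →
    s (b + suc l) ≡ a → Agree (suc b + suc l) 0 n → ⊥
  noMonochromaticBlock em {n} {a} b l here differ l<n sl≡a sb≡a sc≡a there =
    firstOccurrence (least em Occurs (suc b) (λ _ → refl))
    where
    palindrome : ∀ {t u} → suc (t + u) ≡ n → s t ≡ s u
    palindrome = rightSpecialPrefix-palindrome here differ

    next≡a : s (suc b + n) ≡ a
    -- As `n` is `suc l + e`, the positions `l` and `e` mirror each other in p.
    next≡a with e , refl ← m≤n⇒∃[o]m+o≡n l<n = begin
      s (suc b + (suc l + e))  ≡⟨ cong s (sym (+-assoc (suc b) (suc l) e)) ⟩
      s (suc b + suc l + e)    ≡⟨ there (s≤s (m≤n+m e l)) ⟩
      s e                      ≡⟨ sym (palindrome refl) ⟩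
      s l                      ≡⟨ sl≡a ⟩
      a                        ∎
      where open ≡-Reasoning

    Occurs : ℕ → Set
    Occurs m = Agree m (suc b) (suc n)

    -- If s (suc c + n) were not a, reversing the factor of length n + 2 at
    -- c = b + suc l would make p a left special.
    occurs-next : Occurs (suc b + suc l)
    occurs-next = Agree-∷ʳ (λ t<n → trans (there t<n) (sym (here t<n)))
                           (trans nextNext≡a (sym next≡a))
      where
      nextNext≡a : s (suc b + suc l + n) ≡ a
      nextNext≡a = decidable-stable em λ nextNext≢a → absurd nextNext≢a (reversal c (suc (suc n)))
        where
        c : ℕ
        c = b + suc l
        absurd : s (suc c + n) ≢ a →
          ∃[ k ] (∀ {t u} → suc (t + u) ≡ suc (suc n) → s (k + t) ≡ s (c + u)) → ⊥
        absurd nextNext≢a (k , rev) =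
          differ (leftSpecial⇒prefix sb≢sk (λ t<1+n → sym (reversed t<1+n)) ≤-refl)
          where
          sk≡ : s k ≡ s (suc c + n)
          sk≡ = trans (cong s (sym (+-identityʳ k)))
                      (trans (rev refl) (cong s (+-suc c n)))
          sb≢sk : s b ≢ s k
          sb≢sk e = nextNext≢a (trans (sym sk≡) (trans (sym e) sb≡a))
          inner : Agree (suc k) (suc b) n
          inner {t} t<n with u , t+u≡n ← m≤n⇒∃[o]m+o≡n t<n = begin
            s (suc k + t)  ≡⟨ cong s (sym (+-suc k t)) ⟩
            s (k + suc t)  ≡⟨ rev (cong suc (trans (+-suc (suc t) u) (cong suc t+u≡n))) ⟩
            s (c + suc u)  ≡⟨ cong s (+-suc c u) ⟩
            s (suc c + u)  ≡⟨ there (subst (u <_) t+u≡n (s≤s (m≤n+m u t))) ⟩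
            s u            ≡⟨ sym (palindrome t+u≡n) ⟩
            s t            ≡⟨ sym (here t<n) ⟩
            s (suc b + t)  ∎
            where open ≡-Reasoning
          final : s (suc k + n) ≡ s (suc b + n)
          final = begin
            s (suc k + n)  ≡⟨ cong s (sym (+-suc k n)) ⟩
            s (k + suc n)  ≡⟨ rev (cong (suc ∘ suc) (+-identityʳ n)) ⟩
            s (c + 0)      ≡⟨ cong s (+-identityʳ c) ⟩
            s c            ≡⟨ sc≡a ⟩
            a              ≡⟨ sym next≡a ⟩
            s (suc b + n)  ∎
            where open ≡-Reasoning
          reversed : Agree (suc k) (suc b) (suc n)
          reversed = Agree-∷ʳ inner final

    firstOccurrence : ∃[ i ] (Occurs i × (∀ {k} → k < i → ¬ Occurs k)) → ⊥
    firstOccurrence (zero , occ , _) = differ (sym (occ ≤-refl))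
    firstOccurrence (i@(suc i₀) , occ , first) = main
      where
      -- Induction on the number `d` of letters read backwards. If the next letters differed, the
      -- common word after them, which has p a at offset `d`, would be left special and hence a
      -- prefix; p a would then occur at `d`, before `i`.
      history : ∀ d {i′ m′} → d + i′ ≡ i → Occurs (d + m′) → Agree m′ i′ (d + suc n)
      history zero    refl occₘ t<1+n = trans (occₘ t<1+n) (sym (occ t<1+n))
      history (suc d) {i′} {m′} d+i′≡i occₘ = Agree-∷ same tail
        where
        d+1+i′≡i : d + suc i′ ≡ i
        d+1+i′≡i = trans (+-suc d i′) d+i′≡i
        tail : Agree (suc m′) (suc i′) (d + suc n)
        tail = history d d+1+i′≡i (subst Occurs (sym (+-suc d m′)) occₘ)
        same : s m′ ≡ s i′
        same = decidable-stable em λ m≢i →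
          let prefix = leftSpecial⇒prefix (m≢i ∘ sym) (λ t<ℓ → sym (tail t<ℓ)) in
          first (subst (d <_) d+1+i′≡i (m<m+n d z<s)) λ {t} t<1+n → begin
            s (d + t)             ≡⟨ sym (prefix (+-monoʳ-< d t<1+n)) ⟩
            s (suc i′ + (d + t))  ≡⟨ cong s (sym (+-assoc (suc i′) d t)) ⟩
            s (suc i′ + d + t)    ≡⟨ cong (λ v → s (v + t)) (trans (+-comm (suc i′) d) d+1+i′≡i) ⟩
            s (i + t)             ≡⟨ occ t<1+n ⟩
            s (suc b + t)         ∎
          where open ≡-Reasoning

      beforeFirst≡a : s i₀ ≡ a
      beforeFirst≡a = begin
        s i₀        ≡⟨ cong s (sym (+-identityʳ i₀)) ⟩
        s (i₀ + 0)  ≡⟨ sym (history 1 {i₀} {b} refl (λ _ → refl) z<s) ⟩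
        s (b + 0)   ≡⟨ cong s (+-identityʳ b) ⟩
        s b         ≡⟨ sb≡a ⟩
        a           ∎
        where open ≡-Reasoning

      main : ⊥
      main with ≤-<-connex i n
      -- Position `n` falls inside the occurrence of p at `i`, at offset `e`, whose mirror is `i₀`.
      ... | inj₁ i≤n with e , i+e≡n ← m≤n⇒∃[o]m+o≡n i≤n =
        differ (trans next≡a (sym (begin
          s n            ≡⟨ cong s (sym i+e≡n) ⟩
          s (i + e)      ≡⟨ occ (m<n⇒m<1+n e<n) ⟩
          s (suc b + e)  ≡⟨ here e<n ⟩
          s e            ≡⟨ sym (palindrome i+e≡n) ⟩
          s i₀           ≡⟨ beforeFirst≡a ⟩
          a              ∎)))
        where
        open ≡-Reasoning
        e<n : e < n
        e<n = subst (e <_) i+e≡n (s≤s (m≤n+m e i₀))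
      -- Reading `suc l` letters back from the occurrence at `suc b + suc l` leads to `suc b`, where
      -- p a occurs; the same distance before `i` it must occur at `i′`.
      ... | inj₂ n<i with i′ , l+i′≡i ← m≤n⇒∃[o]m+o≡n (<⇒≤ (≤-<-trans l<n n<i)) =
        first (subst (i′ <_) l+i′≡i (s≤s (m≤n+m i′ l)))
          λ t<1+n → sym (history (suc l) l+i′≡i
            (subst Occurs (+-comm (suc b) (suc l)) occurs-next)
            (<-≤-trans t<1+n (m≤n+m (suc n) (suc l))))

-- Positions of the blocks.

module Factorization {A : Set} (s : InfiniteWord A) (U : ℕ → List⁺ A)
  (factorization : IsFactorization s U) (prefix : ∀ i → IsPrefix (toList (U i)) s) where

  product : ℕ → List A
  product n = concat (applyUpTo (toList ∘ U) n)

  start : ℕ → ℕ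
  start = length ∘ product

  -- This is also the index of the block's last letter.
  pred-size : ℕ → ℕ
  pred-size j = length (List⁺.tail (U j))

  product-suc : ∀ j → product (suc j) ≡ product j ++ toList (U j)
  product-suc j = begin
    concat (applyUpTo (toList ∘ U) (suc j))
      ≡⟨ cong concat (sym (applyUpTo-∷ʳ (toList ∘ U) j)) ⟩
    concat (applyUpTo (toList ∘ U) j ++ [ toList (U j) ])
      ≡⟨ sym (concat-++ (applyUpTo (toList ∘ U) j) _) ⟩
    product j ++ concat [ toList (U j) ]
      ≡⟨ cong (product j ++_) concat-[ toList (U j) ] ⟩
    product j ++ toList (U j) ∎
    where open ≡-Reasoning

  start-suc : ∀ j → start (suc j) ≡ start j + suc (pred-size j)
  start-suc j = trans (cong length (product-suc j)) (length-++ (product j))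

  block≡ : ∀ j → toList (U j) ≡ applyUpTo s (suc (pred-size j))
  block≡ j with n , eq ← prefix j =
    trans eq (cong (applyUpTo s) (sym (trans (cong length eq) (length-applyUpTo s n))))

  -- Removing `product j` from the prefix `product (suc j)` reads block `j` off `s` at `start j`;
  -- the block is a prefix as well.
  block-at-start : ∀ j {t} → t < suc (pred-size j) → s (start j + t) ≡ s t
  block-at-start j t<L
    with n , eq ← factorization (suc j)
    with m , eq′ ← ++≡applyUpTo⇒suffix (product j) n (trans (sym (product-suc j)) eq)
    = sym (proj₂ (applyUpTo-injective s _ _ m (trans (sym (block≡ j)) eq′)) t<L)

  last≡ : ∀ j → last (U j) ≡ s (pred-size j)
  last≡ j = last-applyUpTo (U j) s (pred-size j) (block≡ j)

-- Choice of the block by the least mismatch.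

mainTheorem9 : ExcludedMiddle 0ℓ →
    (A : Set) → Finite A →
    (s : InfiniteWord A) → IsStandardEpisturmian s → IsAperiodic s →
    (U : ℕ → List⁺ A) → IsFactorization s U → (∀ i → IsPrefix (toList (U i)) s) →
    ∃[ i ] ∃[ j ] (i ≢ j × last (U i) ≢ last (U j))
mainTheorem9 em A _ s epi aperiodic U factorization prefix =
  decidable-stable em absurd
  where
  open Factorization s U factorization prefix
  open Episturmian s epi

  Mismatch : ℕ → Set
  Mismatch n = ∃[ j ] s (start j + n) ≢ s n

  mismatch : ∃[ n ] Mismatch n
  -- Otherwise `start 1`, positive as block 0 is non-empty, would be a period.
  mismatch = decidable-stable em λ none → aperiodic
    (0 , start 1 , subst (0 <_) (sym (start-suc 0)) z<s , λ n _ →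
      trans (cong s (+-comm n (start 1)))
            (decidable-stable em λ differ → none (n , 1 , differ)))

  absurd : ¬ (∃[ i ] ∃[ j ] (i ≢ j × last (U i) ≢ last (U j))) → ⊥
  absurd monochromatic with least em Mismatch (proj₁ mismatch) (proj₂ mismatch)
  -- Block 0 starts at 0, where no mismatch is possible, so the chosen block has a predecessor.
  ... | n , (zero , differ) , _ = differ refl
  ... | n , (suc j , differ) , first =
    noMonochromaticBlock em b l
      (subst (λ m → Agree m 0 n) start≡ (agree (suc j)))
      (subst (λ m → s (m + n) ≢ s n) start≡ differ)
      l<n
      (ends (suc j))
      (trans (block-at-start j ≤-refl) (ends j))
      (begin
        s (b + suc l)          ≡⟨ cong s (+-suc b l) ⟩
        s (suc b + l)          ≡⟨ cong (λ m → s (m + l)) (sym start≡) ⟩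
        s (start (suc j) + l)  ≡⟨ block-at-start (suc j) ≤-refl ⟩
        s l                    ≡⟨ ends (suc j) ⟩
        last (U 0)             ∎)
      (subst (λ m → Agree m 0 n)
        (trans (start-suc (suc j)) (cong (_+ suc l) start≡)) (agree (suc (suc j))))
    where
    open ≡-Reasoning
    b l : ℕ
    b = start j + pred-size j
    l = pred-size (suc j)
    start≡ : start (suc j) ≡ suc b
    start≡ = trans (start-suc j) (+-suc (start j) (pred-size j))
    agree : ∀ k → Agree (start k) 0 n
    -- `n` is minimal over all blocks together, so p occurs at every block start.
    agree k t<n = decidable-stable em λ e → first t<n (k , e)
    ends : ∀ k → s (pred-size k) ≡ last (U 0)
    ends zero    = sym (last≡ 0)
    ends (suc k) = trans (sym (last≡ (suc k)))
      (decidable-stable em λ e → monochromatic (suc k , 0 , (λ ()) , e))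
    l<n : suc l ≤ n
    -- The block itself copies the beginning of `s`, so the mismatch lies beyond it.
    l<n = ≮⇒≥ (λ n<1+l → differ (block-at-start (suc j) n<1+l))
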